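{- Let $n\ge 71$ and let $G_n=K_2\,\square\,K_n$. Then $\Gamma(G_n\times G_n)=n^2=\Gamma(G_n)^2$.
   Context: $K_m\,\square\,K_n$ is the Cartesian product (rook graph): vertex set $V(K_m)\times V(K_n)$, with $(u,u')$ adjacent to $(v,v')$ iff either $u=v$ and $u'\ne v'$, or $u\ne v$ and $u'=v'$. The direct product $G\times H$ has vertex set $V(G)\times V(H)$, with $(u_G,u_H)$ adjacent to $(v_G,v_H)$ iff $u_Gv_G\in E(G)$ and $u_Hv_H\in E(H)$. A set $D$ is dominating if every vertex is in $D$ or adjacent to a vertex of $D$; it is minimal dominating if no proper subset is dominating. The upper domination number $\Gamma(G)$ is the maximum size of a minimal dominating set of $G$. -}

module Defs where

open import Level using (0ℓ)
open import Data.Nat using (ℕ; _≤_)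
open import Data.Fin using (Fin)
open import Data.Product using (Σ; ∃; ∃-syntax; _×_; _,_)
open import Data.Sum using (_⊎_)
open import Data.List using (List; length)
open import Data.List.Membership.Propositional using (_∈_)
open import Data.List.Relation.Binary.Subset.Propositional using (_⊆_)
open import Data.List.Relation.Unary.Unique.Propositional using (Unique)
open import Relation.Nullary using (¬_)
open import Relation.Binary.PropositionalEquality using (_≡_)

record Graph : Set₁ where
  field
    V   : Set
    Adj : V → V → Set
open Graph public

K : ℕ → Graph
K n = record { V = Fin n ; Adj = λ u v → ¬ (u ≡ v) }

_□_ : Graph → Graph → Graph
G □ H = record
  { V   = V G × V H
  ; Adj = λ { (u , u') (v , v') →
              (u ≡ v × Adj H u' v') ⊎ (Adj G u v × u' ≡ v') } }

_⊠_ : Graph → Graph → Graph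
G ⊠ H = record
  { V   = V G × V H
  ; Adj = λ { (u , u') (v , v') → Adj G u v × Adj H u' v' } }

-- Finite vertex sets are represented by duplicate-free lists; size = length.
Dominating : (G : Graph) → List (V G) → Set
Dominating G D = ∀ v → v ∈ D ⊎ ∃[ u ] (u ∈ D × Adj G u v)

MinimalDominating : (G : Graph) → List (V G) → Set
MinimalDominating G D =
  Dominating G D ×
  (∀ (D' : List (V G)) → D' ⊆ D → ¬ (D ⊆ D') → ¬ Dominating G D')

IsUpperDominationNumber : (G : Graph) → ℕ → Set
IsUpperDominationNumber G k =
  (∃[ D ] (Unique D × MinimalDominating G D × length D ≡ k)) ×
  (∀ (D : List (V G)) → Unique D → MinimalDominating G D → length D ≤ k)

Gn : ℕ → Graph
Gn n = K 2 □ K n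

-- A minimal dominating set D of size N and its private neighbours form families x , y of vertices with
-- x k equal or adjacent to y l exactly when k ≡ l; the roles of x and y are symmetric. In the direct square of
-- the prism view the vertices as four n × n quadrants (a , b). A y in a quadrant confines the x's of that quadrant
-- to a cross, those of a neighbouring quadrant essentially off one line, and those of the opposite quadrant off
-- one cell. If every quadrant Q contained an x or were opposite to a y, each would contain O(n) of the y's; so some
-- quadrant (α , β) has no x while its opposite (α' , β') has no y. Call a column lost if it contains an x in (α , β')
-- or a y in (α' , β), and a row lost if it contains an x in (α' , β) or a y in (α , β'). Without lost rows, each
-- column carries a matching for open adjacency in the prism itself, at most n in size; likewise for columns. With c ≥ 1 lost columns and r ≥ 1 lost rows, classifying the pairs
-- (x k , y k) by quadrants gives N ≤ (n ∸ c) * (n ∸ r) + n + 10 * (c + r) ≤ n * n.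
module Submission where

open import Defs
open import Data.Empty using (⊥-elim)
open import Data.Fin using (Fin; zero; suc; _≟_)
open import Data.Fin.Properties using (any?)
open import Data.List using (List; []; _∷_; length; map; filter; allFin; lookup; cartesianProduct)
open import Data.List.Membership.Propositional using (_∈_; find)
open import Data.List.Membership.Propositional.Properties
  using (∈-filter⁺; ∈-filter⁻; ∈-allFin; ∈-map⁺; ∈-map⁻; ∈-cartesianProduct⁺; ∈-cartesianProduct⁻; ∈-lookup)
open import Data.List.Properties using (length-tabulate; length-map; length-++)
open import Data.List.Relation.Unary.All as All using (All; []; _∷_)
open import Data.List.Relation.Unary.All.Properties using (¬All⇒Any¬; ¬Any⇒All¬)
open import Data.List.Relation.Unary.AllPairs using ([]; _∷_)
open import Data.List.Relation.Unary.Any as Any using (here; there)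
open import Data.List.Relation.Unary.Unique.Propositional using (Unique)
open import Data.List.Relation.Unary.Unique.Propositional.Properties using (allFin⁺; map⁺; cartesianProduct⁺)
open import Data.Nat using (ℕ; zero; suc; _+_; _*_; _≤_; z≤n; s≤s; _≤?_)
open import Data.Nat.Properties
  using (≤-trans; ≤-reflexive; +-comm; +-suc; *-comm; *-identityʳ; +-mono-≤; +-monoʳ-≤; +-monoˡ-≤; +-cancelˡ-≤;
         *-monoˡ-≤; *-monoʳ-≤; m≤m+n; m≤n+m; ≰⇒≥; module ≤-Reasoning)
open import Data.Nat.Tactic.RingSolver using (solve-∀)
open import Data.Product using (∃; ∃-syntax; _×_; _,_; proj₁; proj₂; swap)
import Data.Product as Product
open import Data.Product.Properties using (≡-dec)
open import Data.Sum as Sum using (_⊎_; inj₁; inj₂)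
open import Data.Unit using (⊤)
open import Function using (_∘_; id)
open import Relation.Binary.Definitions using (DecidableEquality)
open import Relation.Binary.PropositionalEquality using (_≡_; _≢_; refl; sym; trans; cong; cong₂; subst)
open import Relation.Nullary using (¬_; Dec; yes; no; contradiction)
open import Relation.Nullary.Decidable using (_×-dec_; _⊎-dec_; ¬?; map′; decidable-stable)

private
  variable
    A B : Set
    P Q R : A → Set
    a b m n N : ℕ

-- Cardinality bounds for predicates

-- Cardinality is bounded through duplicate-free lists, so that a bound makes sense for an arbitrary
-- predicate and passes to subsets and unions without enumerating it.
AtMost : (A → Set) → ℕ → Set
AtMost P m = ∀ ks → Unique ks → All P ks → length ks ≤ m

AtMost-map : (∀ {k} → P k → Q k) → AtMost Q m → AtMost P m
AtMost-map P⇒Q Q≤m ks uniq all = Q≤m ks uniq (All.map P⇒Q all)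

AtMost-weaken : m ≤ n → AtMost P m → AtMost P n
AtMost-weaken m≤n P≤m ks uniq all = ≤-trans (P≤m ks uniq all) m≤n

AtMost-∅ : (∀ {k} → ¬ P k) → AtMost P 0
AtMost-∅ ¬P []      _ _       = z≤n
AtMost-∅ ¬P (k ∷ _) _ (p ∷ _) = contradiction p ¬P

AtMost-single : (∀ {k l} → P k → P l → k ≡ l) → AtMost P 1
AtMost-single eq []          _               _           = z≤n
AtMost-single eq (_ ∷ [])    _               _           = s≤s z≤n
AtMost-single eq (_ ∷ _ ∷ _) ((k≢l ∷ _) ∷ _) (p ∷ q ∷ _) = contradiction (eq p q) k≢l

AtMost-double : (∀ {k l m} → P k → P l → P m → k ≢ l → k ≢ m → l ≡ m) → AtMost P 2
AtMost-double eq []              _ _ = z≤n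
AtMost-double eq (_ ∷ [])        _ _ = s≤s z≤n
AtMost-double eq (_ ∷ _ ∷ [])    _ _ = s≤s (s≤s z≤n)
AtMost-double eq (_ ∷ _ ∷ _ ∷ _) ((k≢l ∷ k≢m ∷ _) ∷ (l≢m ∷ _) ∷ _) (p ∷ q ∷ r ∷ _) =
  contradiction (eq p q r k≢l k≢m) l≢m

-- The final component lets any property of the whole list descend to both halves; with `S` taken as
-- `k ≢_` it carries freshness through the recursion.
split-list : (∀ {k} → R k → P k ⊎ Q k) → ∀ {ks : List A} → Unique ks → All R ks →
  ∃[ ps ] ∃[ qs ] (Unique ps × All P ps × Unique qs × All Q qs × length ks ≡ length ps + length qs
    × (∀ {S : A → Set} → All S ks → All S ps × All S qs))
split-list R⇒ {[]} _ _ = [] , [] , [] , [] , [] , [] , refl , λ _ → [] , []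
split-list R⇒ {k ∷ ks} (k∉ks ∷ uniq) (r ∷ all)
  with split-list R⇒ uniq all | R⇒ r
... | ps , qs , ups , aps , uqs , aqs , eq , sub | inj₁ p =
  k ∷ ps , qs , proj₁ (sub k∉ks) ∷ ups , p ∷ aps , uqs , aqs , cong suc eq ,
  λ { (s ∷ ss) → s ∷ proj₁ (sub ss) , proj₂ (sub ss) }
... | ps , qs , ups , aps , uqs , aqs , eq , sub | inj₂ q =
  ps , k ∷ qs , ups , aps , proj₂ (sub k∉ks) ∷ uqs , q ∷ aqs , trans (cong suc eq) (sym (+-suc _ _)) ,
  λ { (s ∷ ss) → proj₁ (sub ss) , s ∷ proj₂ (sub ss) }

AtMost-∪ : (∀ {k} → R k → P k ⊎ Q k) → AtMost P a → AtMost Q b → AtMost R (a + b)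
AtMost-∪ R⇒ P≤a Q≤b ks uniq all with split-list R⇒ uniq all
... | ps , qs , ups , aps , uqs , aqs , eq , _ =
  ≤-trans (≤-reflexive eq) (+-mono-≤ (P≤a ps ups aps) (Q≤b qs uqs aqs))

AtMost-fibers : (f : A → B) (L : List B) → (∀ {k} → P k → f k ∈ L) →
  (∀ c → AtMost (λ k → P k × f k ≡ c) m) → AtMost P (length L * m)
AtMost-fibers f []      P⇒∈ _   = AtMost-∅ λ p → contradiction (P⇒∈ p) λ ()
AtMost-fibers {P = P} f (c ∷ L) P⇒∈ fib = AtMost-∪ head-or-tail (fib c)
  (AtMost-fibers {P = λ k → P k × f k ∈ L} f L proj₂ λ d → AtMost-map (λ ((p , _) , eq) → p , eq) (fib d))
  where
  head-or-tail : ∀ {k} → P k → (P k × f k ≡ c) ⊎ (P k × f k ∈ L)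
  head-or-tail p with P⇒∈ p
  ... | here eq  = inj₁ (p , eq)
  ... | there ∈L = inj₂ (p , ∈L)

AtMost-injective : (f : A → B) (L : List B) → (∀ {k} → P k → f k ∈ L) →
  (∀ {k l} → P k → P l → f k ≡ f l → k ≡ l) → AtMost P (length L)
AtMost-injective f L P⇒∈ inj = AtMost-weaken (≤-reflexive (*-identityʳ _))
  (AtMost-fibers f L P⇒∈ λ c → AtMost-single λ (p , eq) (q , eq') → inj p q (trans eq (sym eq')))

length-allFin : ∀ n → length (allFin n) ≡ n
length-allFin n = length-tabulate {n = n} id

AtMost-injective-Fin : (f : A → Fin n) → (∀ {k l} → P k → P l → f k ≡ f l → k ≡ l) → AtMost P n
AtMost-injective-Fin {n = n} f inj =
  AtMost-weaken (≤-reflexive (length-allFin n)) (AtMost-injective f (allFin n) (λ {k} _ → ∈-allFin (f k)) inj)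

AtMost-total : {P : Fin N → Set} → (∀ k → P k) → AtMost P m → N ≤ m
AtMost-total {N} all P≤m =
  ≤-trans (≤-reflexive (sym (length-allFin N))) (P≤m (allFin N) (allFin⁺ N) (All.universal all _))

-- Used as a dichotomy: either the images count the family, or a collision supplies the two aligned
-- members that `collinear` asks for.
injective-or-collision : {P : Fin N → Set} → (∀ k → Dec (P k)) → (f : Fin N → Fin n) (L : List (Fin n)) →
  (∀ {k} → P k → f k ∈ L) →
  AtMost P (length L) ⊎ ∃[ k ] ∃[ l ] (P k × P l × k ≢ l × f k ≡ f l)
injective-or-collision P? f L P⇒∈
  with any? (λ k → any? λ l → P? k ×-dec P? l ×-dec ¬? (k ≟ l) ×-dec f k ≟ f l)
... | yes collision = inj₂ collision
... | no  none      = inj₁ (AtMost-injective f L P⇒∈ λ {k} {l} p q eq →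
        decidable-stable (k ≟ l) λ k≢l → none (k , l , p , q , k≢l , eq))

length-filter-¬ : (P? : ∀ (k : A) → Dec (P k)) → ∀ ks →
  length (filter P? ks) + length (filter (λ k → ¬? (P? k)) ks) ≡ length ks
length-filter-¬ P? []       = refl
length-filter-¬ P? (k ∷ ks) with P? k
... | yes _ = cong suc (length-filter-¬ P? ks)
... | no  _ = trans (+-suc _ _) (cong suc (length-filter-¬ P? ks))

-- Minimal dominating sets as matchings

infix 4 _⟦_~_⟧

_⟦_~_⟧ : (G : Graph) → V G → V G → Set
G ⟦ u ~ v ⟧ = u ≡ v ⊎ Adj G u v

-- An induced matching of the closed-neighbourhood relation. Unlike a minimal dominating set, this
-- structure can be reversed, which `dual` exploits.
record Matching (G : Graph) (N : ℕ) : Set where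
  field
    x y  : Fin N → V G
    diag : ∀ k → G ⟦ x k ~ y k ⟧
    off  : ∀ {k l} → G ⟦ x k ~ y l ⟧ → k ≡ l

open Matching

lookup-injective : {D : List A} → Unique D → ∀ {k l} → lookup D k ≡ lookup D l → k ≡ l
lookup-injective (_ ∷ _)      {zero}  {zero}  _  = refl
lookup-injective (x∉ ∷ _)     {zero}  {suc l} eq = contradiction eq (All.lookup x∉ (∈-lookup l))
lookup-injective (x∉ ∷ _)     {suc k} {zero}  eq = contradiction (sym eq) (All.lookup x∉ (∈-lookup k))
lookup-injective (_ ∷ uniq)   {suc k} {suc l} eq = cong suc (lookup-injective uniq eq)

record Finite (G : Graph) : Set where
  field
    _≟ᵥ_     : DecidableEquality (V G)
    adj?     : ∀ u v → Dec (Adj G u v)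
    vertices : List (V G)
    complete : ∀ v → v ∈ vertices

PrivateNeighbour : (G : Graph) → List (V G) → V G → V G → Set
PrivateNeighbour G D x v = G ⟦ x ~ v ⟧ × (∀ {u} → u ∈ D → G ⟦ u ~ v ⟧ → u ≡ x)

module _ {G : Graph} (fin : Finite G) where
  open Finite fin

  dominated? : ∀ D v → Dec (v ∈ D ⊎ ∃[ u ] (u ∈ D × Adj G u v))
  dominated? D v = Any.any? (v ≟ᵥ_) D ⊎-dec
    map′ from to (Any.any? (λ u → adj? u v) D)
    where
    from : ∀ {D v} → Any.Any (λ u → Adj G u v) D → ∃[ u ] (u ∈ D × Adj G u v)
    from (here adj) = _ , here refl , adj
    from (there p) with from p
    ... | u , u∈ , adj = u , there u∈ , adj
    to : ∀ {D v} → ∃[ u ] (u ∈ D × Adj G u v) → Any.Any (λ u → Adj G u v) D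
    to (u , u∈ , adj) = Any.map (λ { refl → adj }) u∈

  -- Without `x` the list no longer dominates, and finiteness turns this into an explicit
  -- undominated `v`. A member of `D` equal or adjacent to `v` can then only be `x`, and there is
  -- one because `D` dominates `v`.
  minimal⇒private : ∀ {D} → MinimalDominating G D → ∀ {x} → x ∈ D → ∃ (PrivateNeighbour G D x)
  minimal⇒private {D} (dom , minimal) {x} x∈D with All.all? (dominated? D-x) vertices
    where D-x = filter (λ u → ¬? (u ≟ᵥ x)) D
  ... | yes all = contradiction (λ v → All.lookup all (complete v))
        (minimal _ (λ u∈ → proj₁ (∈-filter⁻ (λ u → ¬? (u ≟ᵥ x)) u∈))
          (λ D⊆ → proj₂ (∈-filter⁻ (λ u → ¬? (u ≟ᵥ x)) {xs = D} (D⊆ x∈D)) refl))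
  ... | no ¬all = v , own , only
    where
    D-x = filter (λ u → ¬? (u ≟ᵥ x)) D
    found = Any.satisfied (¬All⇒Any¬ (dominated? D-x) vertices ¬all)
    v = proj₁ found
    only : ∀ {u} → u ∈ D → G ⟦ u ~ v ⟧ → u ≡ x
    only {u} u∈D u~v with u ≟ᵥ x
    ... | yes u≡x = u≡x
    ... | no  u≢x = ⊥-elim (proj₂ found (dominates u~v))
      where
      u∈D-x : u ∈ D-x
      u∈D-x = ∈-filter⁺ (λ u → ¬? (u ≟ᵥ x)) u∈D u≢x
      dominates : G ⟦ u ~ v ⟧ → v ∈ D-x ⊎ ∃[ u ] (u ∈ D-x × Adj G u v)
      dominates (inj₁ refl) = inj₁ u∈D-x
      dominates (inj₂ adj)  = inj₂ (u , u∈D-x , adj)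
    own : G ⟦ x ~ v ⟧
    own with dom v
    ... | inj₁ v∈D             = inj₁ (sym (only v∈D (inj₁ refl)))
    ... | inj₂ (u , u∈D , adj) = subst (λ u → G ⟦ u ~ v ⟧) (only u∈D (inj₂ adj)) (inj₂ adj)

  minimal⇒matching : ∀ {D} → Unique D → MinimalDominating G D → Matching G (length D)
  minimal⇒matching {D} uniq min = record
    { x    = lookup D
    ; y    = λ k → proj₁ (private-of k)
    ; diag = λ k → proj₁ (proj₂ (private-of k))
    ; off  = λ {k} {l} k~l → lookup-injective uniq (proj₂ (proj₂ (private-of l)) (∈-lookup k) k~l)
    }
    where
    private-of : ∀ k → ∃ (PrivateNeighbour G D (lookup D k))
    private-of k = minimal⇒private min (∈-lookup k)

-- A dominating subset of `D` must dominate the private neighbour of each `x`, which only `x` can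
-- do; hence it contains all of `D`.
private⇒minimal : ∀ {G D} → Dominating G D → (∀ {x} → x ∈ D → ∃ (PrivateNeighbour G D x)) →
  MinimalDominating G D
private⇒minimal {G} {D} dom priv = dom , λ D' D'⊆D D⊈D' dom' → D⊈D' λ {x} x∈D →
  retained D'⊆D (proj₂ (priv x∈D)) (dom' (proj₁ (priv x∈D)))
  where
  retained : ∀ {D' x v} → (∀ {u} → u ∈ D' → u ∈ D) → PrivateNeighbour G D x v →
    v ∈ D' ⊎ ∃[ u ] (u ∈ D' × Adj G u v) → x ∈ D'
  retained D'⊆D (_ , only) (inj₁ v∈D') = subst (_∈ _) (only (D'⊆D v∈D') (inj₁ refl)) v∈D'
  retained D'⊆D (_ , only) (inj₂ (u , u∈D' , adj)) =
    subst (_∈ _) (only (D'⊆D u∈D') (inj₂ adj)) u∈D'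

-- The prism K₂ □ Kₙ

Fin2-cases : ∀ {α α' : Fin 2} → α ≢ α' → ∀ β → β ≡ α ⊎ β ≡ α'
Fin2-cases {zero}     {zero}     α≢ _          = contradiction refl α≢
Fin2-cases {zero}     {suc zero} α≢ zero       = inj₁ refl
Fin2-cases {zero}     {suc zero} α≢ (suc zero) = inj₂ refl
Fin2-cases {suc zero} {zero}     α≢ zero       = inj₂ refl
Fin2-cases {suc zero} {zero}     α≢ (suc zero) = inj₁ refl
Fin2-cases {suc zero} {suc zero} α≢ _          = contradiction refl α≢

prism-sym : ∀ {u v : V (Gn n)} → Adj (Gn n) u v → Adj (Gn n) v u
prism-sym (inj₁ (eq , ne)) = inj₁ (sym eq , ne ∘ sym)
prism-sym (inj₂ (ne , eq)) = inj₂ (ne ∘ sym , sym eq)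

-- Once v k and v l have different first coordinates, every other u m is one of v k and v l.
prism-bound : {P : A → Set} (u v : A → V (Gn n)) → DecidableEquality A → 4 ≤ n →
  (∀ {k l} → P k → P l → k ≢ l → proj₁ (u k) ≡ proj₁ (v l) → proj₂ (u k) ≡ proj₂ (v l)) →
  (∀ {k l} → P k → P l → u k ≡ u l → k ≡ l) →
  (∀ {k l} → P k → P l → v k ≡ v l → k ≡ l) → AtMost P n
prism-bound u v _≟ᵏ_ 4≤n meet u-inj v-inj [] _ _ = z≤n
prism-bound {A} {n = n} {P = P} u v _≟ᵏ_ 4≤n meet u-inj v-inj ks@(k ∷ _) uniq ps@(p ∷ _)
  with Any.any? (λ l → ¬? (proj₁ (v l) ≟ proj₁ (v k))) ks
... | no  none = AtMost-injective-Fin (proj₂ ∘ v)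
        (λ (q , eq) (q' , eq') eq'' → v-inj q q' (cong₂ _,_ (trans eq (sym eq')) eq''))
        ks uniq (All.zip (ps , All.map (decidable-stable (_ ≟ _)) (¬Any⇒All¬ ks none)))
... | yes some = AtMost-weaken 4≤n (AtMost-∪ cases (AtMost-∪ id single single) (AtMost-∪ id (fibre (v k)) (fibre (v l)))) ks uniq ps
  where
  l = proj₁ (find some)
  rows-differ : proj₁ (v k) ≢ proj₁ (v l)
  rows-differ = proj₂ (proj₂ (find some)) ∘ sym
  q : P l
  q = All.lookup ps (proj₁ (proj₂ (find some)))
  single : ∀ {m : A} → AtMost (λ k → k ≡ m) 1
  single = AtMost-single λ { refl refl → refl }
  fibre : ∀ w → AtMost (λ m → P m × u m ≡ w) 1
  fibre w = AtMost-single λ (p , eq) (q , eq') → u-inj p q (trans eq (sym eq'))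
  cases : ∀ {m} → P m → (m ≡ k ⊎ m ≡ l) ⊎ (P m × u m ≡ v k) ⊎ (P m × u m ≡ v l)
  cases {m} r with m ≟ᵏ k | m ≟ᵏ l | Fin2-cases rows-differ (proj₁ (u m))
  ... | yes eq | _      | _       = inj₁ (inj₁ eq)
  ... | no _   | yes eq | _       = inj₁ (inj₂ eq)
  ... | no m≢k | no _   | inj₁ eq = inj₂ (inj₁ (r , cong₂ _,_ eq (meet r p m≢k eq)))
  ... | no _   | no m≢l | inj₂ eq = inj₂ (inj₂ (r , cong₂ _,_ eq (meet r q m≢l eq)))

-- Vertices of one layer with different second coordinates are adjacent, so `off` yields `meet`. The
-- same count serves open adjacency in `column-bound`.
prism-matching-bound : 4 ≤ n → Matching (Gn n) N → N ≤ n
prism-matching-bound {n} 4≤n M = AtMost-total {P = λ _ → ⊤} _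
  (prism-bound (x M) (y M) _≟_ 4≤n meet
    (λ {k} {l} _ _ eq → off M (subst (λ u → Gn n ⟦ u ~ y M l ⟧) (sym eq) (diag M l)))
    (λ {k} {l} _ _ eq → off M (subst (λ v → Gn n ⟦ x M k ~ v ⟧) eq (diag M k))))
  where
  meet : ∀ {k l} → ⊤ → ⊤ → k ≢ l → proj₁ (x M k) ≡ proj₁ (y M l) → proj₂ (x M k) ≡ proj₂ (y M l)
  meet {k} {l} _ _ k≢l eq with proj₂ (x M k) ≟ proj₂ (y M l)
  ... | yes eq' = eq'
  ... | no  ne  = contradiction (off M (inj₂ (inj₁ (eq , ne)))) k≢l

prism-adj? : ∀ (u v : V (Gn n)) → Dec (Adj (Gn n) u v)
prism-adj? (a , i) (b , j) = (a ≟ b ×-dec ¬? (i ≟ j)) ⊎-dec (¬? (a ≟ b) ×-dec i ≟ j)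

prism-vertices : ∀ n → List (V (Gn n))
prism-vertices n = cartesianProduct (allFin 2) (allFin n)

prism-finite : ∀ n → Finite (Gn n)
prism-finite n = record
  { _≟ᵥ_     = ≡-dec _≟_ _≟_
  ; adj?     = prism-adj?
  ; vertices = prism-vertices n
  ; complete = λ _ → ∈-cartesianProduct⁺ (∈-allFin _) (∈-allFin _)
  }

⊠-finite : ∀ {G H} → Finite G → Finite H → Finite (G ⊠ H)
⊠-finite fin fin' = record
  { _≟ᵥ_     = ≡-dec (Finite._≟ᵥ_ fin) (Finite._≟ᵥ_ fin')
  ; adj?     = λ (u , u') (v , v') → Finite.adj? fin u v ×-dec Finite.adj? fin' u' v'
  ; vertices = cartesianProduct (Finite.vertices fin) (Finite.vertices fin')
  ; complete = λ _ → ∈-cartesianProduct⁺ (Finite.complete fin _) (Finite.complete fin' _)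
  }

-- The direct square of the prism. A vertex ((a , i) , (b , j)) is the cell (row i , column j) of the
-- quadrant (a , b).

Square : ℕ → Graph
Square n = Gn n ⊠ Gn n

dual : Matching (Square n) N → Matching (Square n) N
dual {n} M = record { x = y M ; y = x M ; diag = λ k → ~-sym (diag M k) ; off = λ k~l → sym (off M (~-sym k~l)) }
  where
  ~-sym : ∀ {u v} → Square n ⟦ u ~ v ⟧ → Square n ⟦ v ~ u ⟧
  ~-sym = Sum.map sym (Product.map prism-sym prism-sym)

-- Exchanging the two factors turns each statement about columns into one about rows, so only the
-- column versions are proved directly.
transpose : Matching (Square n) N → Matching (Square n) N
transpose {n} M = record { x = swap ∘ x M ; y = swap ∘ y M ; diag = λ k → ~-swap (diag M k) ; off = off M ∘ ~-swap }
  where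
  ~-swap : ∀ {u v} → Square n ⟦ u ~ v ⟧ → Square n ⟦ swap u ~ swap v ⟧
  ~-swap = Sum.map (cong swap) swap

module _ (M : Matching (Square n) N) where

  xa xb ya yb : Fin N → Fin 2
  xa k = proj₁ (proj₁ (x M k))
  xb k = proj₁ (proj₂ (x M k))
  ya k = proj₁ (proj₁ (y M k))
  yb k = proj₁ (proj₂ (y M k))

  xi xj yi yj : Fin N → Fin n
  xi k = proj₂ (proj₁ (x M k))
  xj k = proj₂ (proj₂ (x M k))
  yi k = proj₂ (proj₁ (y M k))
  yj k = proj₂ (proj₂ (y M k))

  InX InY : Fin 2 → Fin 2 → Fin N → Set
  InX α β k = xa k ≡ α × xb k ≡ β
  InY α β k = ya k ≡ α × yb k ≡ β

  Link : (α β γ δ : Fin 2) → Fin N → Set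
  Link α β γ δ k = InY α β k × InX γ δ k

  inX? : ∀ α β k → Dec (InX α β k)
  inX? α β k = xa k ≟ α ×-dec xb k ≟ β

  inY? : ∀ α β k → Dec (InY α β k)
  inY? α β k = ya k ≟ α ×-dec yb k ≟ β

  link? : ∀ α β γ δ k → Dec (Link α β γ δ k)
  link? α β γ δ k = inY? α β k ×-dec inX? γ δ k

  -- Cells of one quadrant are adjacent exactly when they differ in both row and column;
  -- non-adjacency puts `x k` on the cross through `y l`.
  off-same : ∀ {k l} → xa k ≡ ya l → xb k ≡ yb l → k ≢ l → xi k ≡ yi l ⊎ xj k ≡ yj l
  off-same {k} {l} ea eb k≢l with xi k ≟ yi l | xj k ≟ yj l
  ... | yes ei | _      = inj₁ ei
  ... | no _   | yes ej = inj₂ ej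
  ... | no ni  | no nj  = contradiction (off M (inj₂ (inj₁ (ea , ni) , inj₁ (eb , nj)))) k≢l

  -- Cells of these two neighbouring quadrants are adjacent exactly when they share the column and
  -- differ in the row. In the column of `y l` this leaves `x k` a single cell.
  off-col : ∀ {k l} → xa k ≡ ya l → xb k ≢ yb l → k ≢ l → xj k ≡ yj l → xi k ≡ yi l
  off-col {k} {l} ea nb k≢l ej with xi k ≟ yi l
  ... | yes ei = ei
  ... | no ni  = contradiction (off M (inj₂ (inj₁ (ea , ni) , inj₂ (nb , ej)))) k≢l

  diag-same : ∀ k → xa k ≡ ya k → xb k ≡ yb k → (xi k ≡ yi k × xj k ≡ yj k) ⊎ xj k ≢ yj k
  diag-same k ea eb with diag M k
  ... | inj₁ eq                    = inj₁ (cong (proj₂ ∘ proj₁) eq , cong (proj₂ ∘ proj₂) eq)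
  ... | inj₂ (_ , inj₁ (_ , nj))   = inj₂ nj
  ... | inj₂ (_ , inj₂ (nb , _))   = contradiction eb nb

  diag-col : ∀ k → xb k ≢ yb k → xj k ≡ yj k
  diag-col k nb with diag M k
  ... | inj₁ eq                   = contradiction (cong (proj₁ ∘ proj₂) eq) nb
  ... | inj₂ (_ , inj₁ (eb , _))  = contradiction eb nb
  ... | inj₂ (_ , inj₂ (_ , ej))  = ej

  diag-row : ∀ k → xa k ≢ ya k → xi k ≡ yi k
  diag-row k na with diag M k
  ... | inj₁ eq                   = contradiction (cong (proj₁ ∘ proj₁) eq) na
  ... | inj₂ (inj₁ (ea , _) , _)  = contradiction ea na
  ... | inj₂ (inj₂ (_ , ei) , _)  = ei

  x-injective : ∀ {k l} → x M k ≡ x M l → k ≡ l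
  x-injective {k} {l} eq = off M (subst (λ u → Square n ⟦ u ~ y M l ⟧) (sym eq) (diag M l))

  x-cell-injective : ∀ {α β k l} → InX α β k → InX α β l → xi k ≡ xi l → xj k ≡ xj l → k ≡ l
  x-cell-injective (ea , eb) (ea' , eb') ei ej =
    x-injective (cong₂ _,_ (cong₂ _,_ (trans ea (sym ea')) ei) (cong₂ _,_ (trans eb (sym eb')) ej))

y-injective : (M : Matching (Square n) N) → ∀ {k l} → y M k ≡ y M l → k ≡ l
y-injective M = x-injective (dual M)

y-cell-injective : (M : Matching (Square n) N) → ∀ {α β k l} → InY M α β k → InY M α β l →
  yi M k ≡ yi M l → yj M k ≡ yj M l → k ≡ l
y-cell-injective M = x-cell-injective (dual M)

-- Crosses and the size of a single quadrant

cross-bound : (M : Matching (Square n) N) → ∀ {α β} {P : Fin N → Set} (C : List (Fin n)) i₀ j₀ →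
  (∀ {k} → P k → InX M α β k) → (∀ {k} → P k → xj M k ∈ C) →
  (∀ {k} → P k → xi M k ≡ i₀ ⊎ xj M k ≡ j₀) → AtMost P (n + length C)
cross-bound M {P = P} C i₀ j₀ inX col cross = AtMost-∪
  {P = λ k → P k × xj M k ≡ j₀} {Q = λ k → P k × xi M k ≡ i₀}
  (λ p → Sum.swap (Sum.map (p ,_) (p ,_) (cross p)))
  -- The vertical arm holds at most one index per row, the horizontal arm at most one per column of
  -- `C`.
  (AtMost-injective-Fin (xi M) λ (p , ej) (q , ej') ei → x-cell-injective M (inX p) (inX q) ei (trans ej (sym ej')))
  (AtMost-injective (xj M) C (col ∘ proj₁)
    λ (p , ei) (q , ei') ej → x-cell-injective M (inX p) (inX q) (trans ei (sym ei')) ej)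

InX-bound : (M : Matching (Square n) N) → ∀ {α β m} → InY M α β m → AtMost (InX M α β) (1 + (n + n))
InX-bound {n = n} M {α} {β} {m} (ma , mb) = AtMost-weaken (+-monoʳ-≤ (1 + n) (≤-reflexive (length-allFin n)))
  -- The partner `x M m` of the centre may lie off the cross and is counted apart.
  (AtMost-∪ {P = λ k → k ≡ m} {Q = λ k → InX M α β k × k ≢ m} cases
    (AtMost-single λ { refl refl → refl })
    (cross-bound M (allFin n) (yi M m) (yj M m) proj₁ (λ _ → ∈-allFin _)
      λ ((ka , kb) , k≢m) → off-same M (trans ka (sym ma)) (trans kb (sym mb)) k≢m))
  where
  cases : ∀ {k} → InX M α β k → k ≡ m ⊎ (InX M α β k × k ≢ m)
  cases {k} p with k ≟ m
  ... | yes eq = inj₁ eq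
  ... | no  ne = inj₂ (p , ne)

InY-bound : (M : Matching (Square n) N) → ∀ {α β m} → InX M α β m → AtMost (InY M α β) (1 + (n + n))
InY-bound M = InX-bound (dual M)

transpose-link : (M : Matching (Square n) N) → ∀ {α β γ δ k} → Link M α β γ δ k → Link (transpose M) β α δ γ k
transpose-link M = Product.map swap swap

-- Each pair shares its column. Given one pair `k` of a column, `off-col` forces every other `x` of
-- that column into the row of `y M k`, hence into one cell: two pairs per column at most.
adjacent-col-bound : (M : Matching (Square n) N) → ∀ {α β β'} (C : List (Fin n)) → β ≢ β' →
  (∀ {k} → Link M α β α β' k → xj M k ∈ C) → AtMost (Link M α β α β') (length C * 2)
adjacent-col-bound M {α} {β} {β'} C β≢β' col = AtMost-fibers (xj M) C col λ _ →
  AtMost-double λ (p , ep) (q , eq) (r , er) k≢l k≢m →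
    x-cell-injective M (proj₂ q) (proj₂ r)
      (trans (aligned p q k≢l (trans eq (sym ep))) (sym (aligned p r k≢m (trans er (sym ep)))))
      (trans eq (sym er))
  where
  aligned : ∀ {k l} → Link M α β α β' k → Link M α β α β' l → k ≢ l → xj M l ≡ xj M k → xi M l ≡ yi M k
  aligned {k} ((ka , kb) , (_ , kb')) (_ , (la , lb)) k≢l ej =
    off-col M (trans la (sym ka)) (λ eq → β≢β' (trans (sym kb) (trans (sym eq) lb))) (k≢l ∘ sym)
      (trans ej (diag-col M k λ eq → β≢β' (trans (sym kb) (trans (sym eq) kb'))))

adjacent-row-bound : (M : Matching (Square n) N) → ∀ {α α' β} (R : List (Fin n)) → α ≢ α' →
  (∀ {k} → Link M α β α' β k → xi M k ∈ R) → AtMost (Link M α β α' β) (length R * 2)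
adjacent-row-bound M R α≢α' row = AtMost-map (transpose-link M)
  (adjacent-col-bound (transpose M) R α≢α' (row ∘ transpose-link (transpose M)))

-- The partners of these `y` lie in the three other quadrants. A `y` in the opposite quadrant
-- confines the partners there to a cross; the two neighbouring quadrants allow two pairs per column
-- or per row.
quadrant-adjacent-bound : (M : Matching (Square n) N) → ∀ {α α' β β'} → α ≢ α' → β ≢ β' →
  (∀ {k} → ¬ InX M α β k) → (∃[ k ] InY M α' β' k) → AtMost (InY M α β) ((1 + (n + n)) + (n * 2 + n * 2))
quadrant-adjacent-bound {n = n} M {α} {α'} {β} {β'} α≢α' β≢β' noX (m , m∈) = AtMost-∪ cases
  (AtMost-map proj₂ (InX-bound M m∈))
  (AtMost-∪ id
    (AtMost-weaken (*-monoˡ-≤ 2 (≤-reflexive (length-allFin n))) (adjacent-col-bound M (allFin n) β≢β' λ _ → ∈-allFin _))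
    (AtMost-weaken (*-monoˡ-≤ 2 (≤-reflexive (length-allFin n))) (adjacent-row-bound M (allFin n) α≢α' λ _ → ∈-allFin _)))
  where
  cases : ∀ {k} → InY M α β k → Link M α β α' β' k ⊎ Link M α β α β' k ⊎ Link M α β α' β k
  cases {k} p with Fin2-cases α≢α' (xa M k) | Fin2-cases β≢β' (xb M k)
  ... | inj₁ ea | inj₁ eb = contradiction (ea , eb) noX
  ... | inj₁ ea | inj₂ eb = inj₂ (inj₁ (p , ea , eb))
  ... | inj₂ ea | inj₁ eb = inj₂ (inj₂ (p , ea , eb))
  ... | inj₂ ea | inj₂ eb = inj₁ (p , ea , eb)

quadrant-bound : (M : Matching (Square n) N) → ∀ {α α' β β'} → α ≢ α' → β ≢ β' →
  (∃[ k ] (InX M α β k ⊎ InY M α' β' k)) → AtMost (InY M α β) (1 + n * 6)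
quadrant-bound {n = n} M {α} {α'} {β} {β'} α≢α' β≢β' (m , m∈) with any? (inX? M α β) | m∈
... | yes (l , l∈) | _        = AtMost-weaken small (InY-bound M l∈)
  where
  small : 1 + (n + n) ≤ 1 + n * 6
  small = ≤-trans (m≤m+n _ (n * 4)) (≤-reflexive (eq n))
    where
    eq : ∀ n → 1 + (n + n) + n * 4 ≡ 1 + n * 6
    eq = solve-∀
... | no none      | inj₁ p   = contradiction (m , p) none
... | no none      | inj₂ q   = AtMost-weaken (≤-reflexive (eq n))
        (quadrant-adjacent-bound M α≢α' β≢β' (λ p → none (_ , p)) (m , q))
  where
  eq : ∀ n → (1 + (n + n)) + (n * 2 + n * 2) ≡ 1 + n * 6
  eq = solve-∀

-- All `x` and all `y` lie in different layers of the second factor, so adjacency in that factor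
-- means equality of columns. Inside a column what remains is open adjacency in the first factor,
-- where `x` and `y` may coincide without being adjacent; `prism-bound` allows at most `n` indices
-- there.
column-bound : (M : Matching (Square n) N) → ∀ {β β'} → 4 ≤ n → β ≢ β' →
  (∀ k → yb M k ≡ β × xb M k ≡ β') → N ≤ n * n
column-bound {n} M {β} {β'} 4≤n β≢β' split = ≤-trans
  (AtMost-total {P = λ _ → ⊤} _
    (AtMost-fibers (yj M) (allFin n) (λ _ → ∈-allFin _) λ j →
      prism-bound {P = λ k → ⊤ × yj M k ≡ j} (proj₁ ∘ x M) (proj₁ ∘ y M) _≟_ 4≤n
        (λ {k} {l} (_ , kj) (_ , lj) k≢l ea → off-col M ea (xb≢yb k l) k≢l (trans (x-col k) (trans kj (sym lj))))
        (λ {k} {l} (_ , kj) (_ , lj) eq → x-injective M (cong₂ _,_ eq (cong₂ _,_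
          (trans (proj₂ (split k)) (sym (proj₂ (split l))))
          (trans (x-col k) (trans kj (trans (sym lj) (sym (x-col l))))))))
        (λ {k} {l} (_ , kj) (_ , lj) eq → y-injective M (cong₂ _,_ eq (cong₂ _,_
          (trans (proj₁ (split k)) (sym (proj₁ (split l)))) (trans kj (sym lj)))))))
  (*-monoˡ-≤ n (≤-reflexive (length-allFin n)))
  where
  xb≢yb : ∀ k l → xb M k ≢ yb M l
  xb≢yb k l eq = β≢β' (trans (sym (proj₁ (split l))) (trans (sym eq) (proj₂ (split k))))
  x-col : ∀ k → xj M k ≡ yj M k
  x-col k = diag-col M k (xb≢yb k k)

-- `x M m` lies on the crosses of both `y`. These share their column but not their row, so the
-- common column is the only place left.
collinear : (M : Matching (Square n) N) → ∀ {α β k l m} → InY M α β k → InY M α β l → k ≢ l → yj M k ≡ yj M l →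
  InX M α β m → m ≢ k → m ≢ l → xj M m ≡ yj M k
collinear M k∈@(ka , kb) l∈@(la , lb) k≢l ej (ma , mb) m≢k m≢l
  with off-same M (trans ma (sym ka)) (trans mb (sym kb)) m≢k | off-same M (trans ma (sym la)) (trans mb (sym lb)) m≢l
... | inj₂ eq | _       = eq
... | inj₁ _  | inj₂ eq = trans eq (sym ej)
... | inj₁ e  | inj₁ e' = contradiction (y-cell-injective M k∈ l∈ (trans (sym e) e') ej) k≢l

-- Counting in the presence of both lost columns and lost rows

LostColumn : Matching (Square n) N → (α α' β β' : Fin 2) → Fin n → Set
LostColumn M α α' β β' j = ∃[ k ] ((InX M α β' k × xj M k ≡ j) ⊎ (InY M α' β k × yj M k ≡ j))

LostRow : Matching (Square n) N → (α α' β β' : Fin 2) → Fin n → Set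
LostRow M α α' β β' = LostColumn (transpose M) β β' α α'

lostColumn? : (M : Matching (Square n) N) → ∀ α α' β β' j → Dec (LostColumn M α α' β β' j)
lostColumn? M α α' β β' j = any? λ k →
  (inX? M α β' k ×-dec xj M k ≟ j) ⊎-dec (inY? M α' β k ×-dec yj M k ≟ j)

-- `C` and `R` contain the lost lines, `C⁻` and `R⁻` the surviving ones. Only covering is recorded,
-- which makes transposition an exchange of fields; the lengths are related to `n` in the final
-- estimate.
record Frame (M : Matching (Square n) N) (α α' β β' : Fin 2) (C C⁻ R R⁻ : List (Fin n)) : Set where
  field
    α≢α'   : α ≢ α'
    β≢β'   : β ≢ β'
    col    : ∀ {j} → LostColumn M α α' β β' j → j ∈ C
    row    : ∀ {i} → LostRow M α α' β β' i → i ∈ R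
    col⁻   : ∀ j → LostColumn M α α' β β' j ⊎ j ∈ C⁻
    row⁻   : ∀ i → LostRow M α α' β β' i ⊎ i ∈ R⁻

  x-col : ∀ {k} → InX M α β' k → xj M k ∈ C
  x-col p = col (_ , inj₁ (p , refl))
  y-col : ∀ {k} → InY M α' β k → yj M k ∈ C
  y-col p = col (_ , inj₂ (p , refl))
  x-row : ∀ {k} → InX M α' β k → xi M k ∈ R
  x-row p = row (_ , inj₁ (swap p , refl))
  y-row : ∀ {k} → InY M α β' k → yi M k ∈ R
  y-row p = row (_ , inj₂ (swap p , refl))

open Frame

frame-transpose : ∀ {M : Matching (Square n) N} {α α' β β' C C⁻ R R⁻} →
  Frame M α α' β β' C C⁻ R R⁻ → Frame (transpose M) β β' α α' R R⁻ C C⁻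
frame-transpose F = record
  { α≢α' = β≢β' F ; β≢β' = α≢α' F ; col = row F ; row = col F ; col⁻ = row⁻ F ; row⁻ = col⁻ F }

module _ {M : Matching (Square n) N} {α α' β β' C C⁻ R R⁻} (F : Frame M α α' β β' C C⁻ R R⁻) where

  -- Pairs differing in column number at most two per column of `C`, as for neighbouring quadrants.
  -- Coinciding pairs either have distinct columns in `C`, or two of them share a column;
  -- `collinear` then gathers all of them there, and their rows in `R` count them.
  self-link-bound : AtMost (Link M α β' α β') (length C * 2 + (length C + length R))
  self-link-bound = AtMost-∪ cases generic isolated
    where
    Isolated Generic : Fin N → Set
    Isolated k = Link M α β' α β' k × (xi M k ≡ yi M k × xj M k ≡ yj M k)
    Generic k = Link M α β' α β' k × xj M k ≢ yj M k

    cases : ∀ {k} → Link M α β' α β' k → Generic k ⊎ Isolated k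
    cases {k} p@((ya≡ , yb≡) , (xa≡ , xb≡)) =
      Sum.swap (Sum.map (p ,_) (p ,_) (diag-same M k (trans xa≡ (sym ya≡)) (trans xb≡ (sym yb≡))))

    generic : AtMost Generic (length C * 2)
    generic = AtMost-fibers (xj M) C (λ ((_ , p) , _) → x-col F p) λ _ →
      AtMost-double λ (p , ep) (q , eq) (r , er) k≢l k≢m →
        x-cell-injective M (proj₂ (proj₁ q)) (proj₂ (proj₁ r))
          (trans (aligned p q k≢l (trans eq (sym ep))) (sym (aligned p r k≢m (trans er (sym ep)))))
          (trans eq (sym er))
      where
      aligned : ∀ {k l} → Generic k → Generic l → k ≢ l → xj M l ≡ xj M k → xi M l ≡ yi M k
      aligned (((ka , kb) , _) , nj) ((_ , (la , lb)) , _) k≢l ej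
        with off-same M (trans la (sym ka)) (trans lb (sym kb)) (k≢l ∘ sym)
      ... | inj₁ ei  = ei
      ... | inj₂ ej' = contradiction (trans (sym ej) ej') nj

    isolated? : ∀ k → Dec (Isolated k)
    isolated? k = link? M α β' α β' k ×-dec xi M k ≟ yi M k ×-dec xj M k ≟ yj M k

    isolated : AtMost Isolated (length C + length R)
    isolated with injective-or-collision isolated? (xj M) C (λ ((_ , p) , _) → x-col F p)
    ... | inj₁ bound = AtMost-weaken (m≤m+n _ _) bound
    ... | inj₂ (k , l , ((k∈ , _) , (_ , kj)) , ((l∈ , _) , (_ , lj)) , k≢l , ej) =
      AtMost-weaken (m≤n+m _ _) (AtMost-injective (yi M) R (λ ((p , _) , _) → y-row F p)
        λ p q ei → y-cell-injective M (proj₁ (proj₁ p)) (proj₁ (proj₁ q)) ei (trans (forced p) (sym (forced q))))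
      where
      forced : ∀ {m} → Isolated m → yj M m ≡ yj M k
      forced {m} ((_ , m∈) , (_ , mj)) with m ≟ k | m ≟ l
      ... | yes refl | _        = refl
      ... | no _     | yes refl = trans (sym lj) (trans (sym ej) kj)
      ... | no m≢k   | no m≢l   = trans (sym mj)
            (collinear M k∈ l∈ k≢l (trans (sym kj) (trans ej lj)) m∈ m≢k m≢l)

  -- In opposite quadrants `x` and `y` of a pair occupy the same cell. The vertex that makes the
  -- column lost neighbours the quadrant of one of them, and `off-col` fixes their row: one pair per
  -- lost column.
  lost-cells-bound : AtMost (λ k → Link M α β α' β' k × LostColumn M α α' β β' (xj M k)) (length C)
  lost-cells-bound = AtMost-injective (xj M) C (col F ∘ proj₂) inj
    where
    cell : ∀ {k} → Link M α β α' β' k → xi M k ≡ yi M k × xj M k ≡ yj M k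
    cell {k} ((ka , kb) , (ka' , kb')) =
      diag-row M k (λ eq → α≢α' F (trans (sym ka) (trans (sym eq) ka'))) ,
      diag-col M k (λ eq → β≢β' F (trans (sym kb) (trans (sym eq) kb')))
    inj : ∀ {k l} → Link M α β α' β' k × LostColumn M α α' β β' (xj M k) →
      Link M α β α' β' l × LostColumn M α α' β β' (xj M l) → xj M k ≡ xj M l → k ≡ l
    -- As `k` and `l` share the column, the witness `m` found for `k` fixes the row of both.
    inj {k} {l} (p , m , inj₁ ((ma , mb) , mj)) (q , _) ej = x-cell-injective M (proj₂ p) (proj₂ q)
      (trans (aligned p mj) (sym (aligned q (trans mj ej)))) ej
      where
      aligned : ∀ {k} → Link M α β α' β' k → xj M m ≡ xj M k → xi M k ≡ xi M m
      aligned {k} p@((ka , kb) , (ka' , _)) mj = trans (proj₁ (cell p)) (sym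
        (off-col M (trans ma (sym ka)) (λ eq → β≢β' F (trans (sym kb) (trans (sym eq) mb)))
          (λ { refl → α≢α' F (trans (sym ma) ka') }) (trans mj (proj₂ (cell p)))))
    inj {k} {l} (p , m , inj₂ ((ma , mb) , mj)) (q , _) ej = x-cell-injective M (proj₂ p) (proj₂ q)
      (trans (aligned p mj) (sym (aligned q (trans mj ej)))) ej
      where
      aligned : ∀ {k} → Link M α β α' β' k → yj M m ≡ xj M k → xi M k ≡ yi M m
      aligned {k} ((ka , _) , (ka' , kb')) mj =
        off-col M (trans ka' (sym ma)) (λ eq → β≢β' F (trans (sym mb) (trans (sym eq) kb')))
          (λ { refl → α≢α' F (trans (sym ka) ma) }) (sym mj)

  -- The vertex behind a lost row is an `x` in the quadrant of these `y`, or a `y` in the quadrant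
  -- of these `x`. Either way it centres a cross, whose horizontal arm meets only columns of `C`.
  antipodal-cross-bound : ∃ (LostRow M α α' β β') → AtMost (Link M α' β α β') (n + length C)
  antipodal-cross-bound (_ , m , inj₁ ((mb , ma) , _)) =
    cross-bound (dual M) C (xi M m) (xj M m) proj₁ (y-col F ∘ proj₁)
      λ ((ka , kb) , (ka' , _)) → Sum.map sym sym (off-same M (trans ma (sym ka)) (trans mb (sym kb))
        λ { refl → α≢α' F (trans (sym ka') ma) })
  antipodal-cross-bound (_ , m , inj₂ ((mb , ma) , _)) =
    cross-bound M C (yi M m) (yj M m) proj₂ (x-col F ∘ proj₂)
      λ ((ka , kb) , (ka' , kb')) → off-same M (trans ka' (sym ma)) (trans kb' (sym mb))
        λ { refl → α≢α' F (trans (sym ma) ka) }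

module _ {M : Matching (Square n) N} {α α' β β' C C⁻ R R⁻} (F : Frame M α α' β β' C C⁻ R R⁻)
  (lost-column : ∃ (LostColumn M α α' β β')) (lost-row : ∃ (LostRow M α α' β β')) where

  private
    c c⁻ r r⁻ : ℕ
    c  = length C
    c⁻ = length C⁻
    r  = length R
    r⁻ = length R⁻

  -- Two crosses would cost `2 * n`. If the first family has distinct columns it is at most `c`;
  -- otherwise two of its `y` are collinear and squeeze the `x` of the second family into one
  -- column, leaving at most `r`. So only one cross is paid for.
  antipodal-bound : AtMost (λ k → Link M α' β α β' k ⊎ Link M α β' α' β k) (n + (c + r))
  antipodal-bound with injective-or-collision (link? M α' β α β') (xj M) C (x-col F ∘ proj₂)
  ... | inj₁ bound = AtMost-weaken (≤-reflexive (eq c n r)) (AtMost-∪ id bound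
        (AtMost-map (transpose-link M) (antipodal-cross-bound (frame-transpose F) lost-column)))
    where
    eq : ∀ c n r → c + (n + r) ≡ n + (c + r)
    eq = solve-∀
  ... | inj₂ (k , l , (k∈ , (ka , kb)) , (l∈ , (la , lb)) , k≢l , ej) =
        AtMost-weaken (≤-reflexive (eq c n r)) (AtMost-∪ id (antipodal-cross-bound F lost-row)
          (AtMost-injective (xi M) R (x-row F ∘ proj₂)
            λ p q ei → x-cell-injective M (proj₂ p) (proj₂ q) ei (trans (forced p) (sym (forced q)))))
    where
    eq : ∀ c n r → (n + c) + r ≡ n + (c + r)
    eq = solve-∀
    y-side : ∀ {k} → InY M α' β k → xb M k ≡ β' → xj M k ≡ yj M k
    y-side {k} (_ , kb) kb' = diag-col M k λ eq → β≢β' F (trans (sym kb) (trans (sym eq) kb'))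
    forced : ∀ {m} → Link M α β' α' β m → xj M m ≡ yj M k
    forced ((ma , _) , m∈) = collinear M k∈ l∈ k≢l (trans (sym (y-side k∈ kb)) (trans ej (y-side l∈ lb))) m∈
      (λ { refl → α≢α' F (trans (sym ma) (proj₁ k∈)) }) (λ { refl → α≢α' F (trans (sym ma) (proj₁ l∈)) })

  surviving-cells-bound : AtMost (λ k → Link M α β α' β' k × xj M k ∈ C⁻ × xi M k ∈ R⁻) (c⁻ * r⁻)
  surviving-cells-bound = AtMost-fibers (xj M) C⁻ (proj₁ ∘ proj₂) λ _ →
    AtMost-injective (xi M) R⁻ (proj₂ ∘ proj₂ ∘ proj₁)
      λ (p , ep) (q , eq) ei → x-cell-injective M (proj₂ (proj₁ p)) (proj₂ (proj₁ q)) ei (trans ep (sym eq))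

  full-cells-bound : AtMost (Link M α β α' β') (c + (r + c⁻ * r⁻))
  full-cells-bound = AtMost-∪ cases (lost-cells-bound F)
    (AtMost-∪ id (AtMost-map (Product.map₁ (transpose-link M)) (lost-cells-bound (frame-transpose F))) surviving-cells-bound)
    where
    cases : ∀ {k} → Link M α β α' β' k →
      (Link M α β α' β' k × LostColumn M α α' β β' (xj M k)) ⊎
      (Link M α β α' β' k × LostRow M α α' β β' (xi M k)) ⊎
      (Link M α β α' β' k × xj M k ∈ C⁻ × xi M k ∈ R⁻)
    cases {k} p with col⁻ F (xj M k) | row⁻ F (xi M k)
    ... | inj₁ lost | _         = inj₁ (p , lost)
    ... | inj₂ _    | inj₁ lost = inj₂ (inj₁ (p , lost))
    ... | inj₂ j∈   | inj₂ i∈   = inj₂ (inj₂ (p , j∈ , i∈))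

  adjacent-bound : AtMost (λ k → Link M α β α β' k ⊎ Link M α' β α' β' k) (c * 2 + c * 2)
  adjacent-bound = AtMost-∪ id
    (adjacent-col-bound M C (β≢β' F) (x-col F ∘ proj₂))
    -- Here it is `y` that makes the column lost; `x` shares that column.
    (adjacent-col-bound M C (β≢β' F) λ {k} ((ka , kb) , (_ , kb')) → subst (_∈ C)
      (sym (diag-col M k λ eq → β≢β' F (trans (sym kb) (trans (sym eq) kb')))) (y-col F (ka , kb)))

module _ {M : Matching (Square n) N} {α α' β β' C C⁻ R R⁻} (F : Frame M α α' β β' C C⁻ R R⁻)
  (lost-column : ∃ (LostColumn M α α' β β')) (lost-row : ∃ (LostRow M α α' β β'))
  (noX : ∀ {k} → ¬ InX M α β k) (noY : ∀ {k} → ¬ InY M α' β' k) where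

  private
    c c⁻ r r⁻ : ℕ
    c  = length C
    c⁻ = length C⁻
    r  = length R
    r⁻ = length R⁻

    Full Antipodal ColAdjacent RowAdjacent Self : Fin N → Set
    Full k        = Link M α β α' β' k
    Antipodal k   = Link M α' β α β' k ⊎ Link M α β' α' β k
    ColAdjacent k = Link M α β α β' k ⊎ Link M α' β α' β' k
    RowAdjacent k = Link M α β α' β k ⊎ Link M α β' α' β' k
    Self k        = Link M α β' α β' k ⊎ Link M α' β α' β k

    -- Three quadrants remain for `x` and three for `y`, giving nine types of pair: one full and two
    -- of each other kind.
    classify : ∀ k → Full k ⊎ Antipodal k ⊎ ColAdjacent k ⊎ RowAdjacent k ⊎ Self k
    classify k with Fin2-cases (α≢α' F) (ya M k) | Fin2-cases (β≢β' F) (yb M k)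
                  | Fin2-cases (α≢α' F) (xa M k) | Fin2-cases (β≢β' F) (xb M k)
    ... | _      | _      | inj₁ c | inj₁ d = contradiction (c , d) noX
    ... | inj₂ a | inj₂ b | _      | _      = contradiction (a , b) noY
    ... | inj₁ a | inj₁ b | inj₂ c | inj₂ d = inj₁ ((a , b) , c , d)
    ... | inj₁ a | inj₁ b | inj₁ c | inj₂ d = inj₂ (inj₂ (inj₁ (inj₁ ((a , b) , c , d))))
    ... | inj₁ a | inj₁ b | inj₂ c | inj₁ d = inj₂ (inj₂ (inj₂ (inj₁ (inj₁ ((a , b) , c , d)))))
    ... | inj₁ a | inj₂ b | inj₂ c | inj₂ d = inj₂ (inj₂ (inj₂ (inj₁ (inj₂ ((a , b) , c , d)))))
    ... | inj₁ a | inj₂ b | inj₁ c | inj₂ d = inj₂ (inj₂ (inj₂ (inj₂ (inj₁ ((a , b) , c , d)))))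
    ... | inj₁ a | inj₂ b | inj₂ c | inj₁ d = inj₂ (inj₁ (inj₂ ((a , b) , c , d)))
    ... | inj₂ a | inj₁ b | inj₂ c | inj₂ d = inj₂ (inj₂ (inj₁ (inj₂ ((a , b) , c , d))))
    ... | inj₂ a | inj₁ b | inj₁ c | inj₂ d = inj₂ (inj₁ (inj₁ ((a , b) , c , d)))
    ... | inj₂ a | inj₁ b | inj₂ c | inj₁ d = inj₂ (inj₂ (inj₂ (inj₂ (inj₂ ((a , b) , c , d)))))

  -- The coefficient of `c` is 1 from full pairs, 1 from antipodal, 4 from column-adjacent and 3 + 1
  -- from the two self families; by symmetry that of `r` is also 10.
  lost-lines-bound : N ≤ c⁻ * r⁻ + (n + 10 * (c + r))
  lost-lines-bound = ≤-trans
    (AtMost-total classify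
      (AtMost-∪ {P = Full} id (full-cells-bound F lost-column lost-row)
      (AtMost-∪ {P = Antipodal} id (antipodal-bound F lost-column lost-row)
      (AtMost-∪ {P = ColAdjacent} id (adjacent-bound F lost-column lost-row)
      (AtMost-∪ {P = RowAdjacent} id
        (AtMost-map (Sum.map (transpose-link M) (transpose-link M))
          (adjacent-bound (frame-transpose F) lost-row lost-column))
        (AtMost-∪ {P = Link M α β' α β'} {Q = Link M α' β α' β} id (self-link-bound F)
          (AtMost-map (transpose-link M) (self-link-bound (frame-transpose F)))))))))
    (≤-reflexive (eq c r (c⁻ * r⁻) n))
    where
    eq : ∀ c r s n → (c + (r + s)) + ((n + (c + r)) + ((c * 2 + c * 2) + ((r * 2 + r * 2) +
      ((c * 2 + (c + r)) + (r * 2 + (r + c)))))) ≡ s + (n + 10 * (c + r))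
    eq = solve-∀

-- Arithmetic of the lost lines

many-lost-lines-estimate : ∀ {n c c⁻ r r⁻} → c + c⁻ ≡ n → r + r⁻ ≡ n → 21 ≤ c →
  c⁻ * r⁻ + (n + 10 * (c + r)) ≤ n * n
many-lost-lines-estimate {n} {c} {u} {r} {v} c+u r+v 21≤c = begin
  -- Since `c + r` is at most `2 * n`, the extra terms are at most `21 * n`, the content of 21 lost
  -- columns.
  u * v + (n + 10 * (c + r))   ≤⟨ +-mono-≤ (*-monoʳ-≤ u v≤n) (+-monoʳ-≤ n (*-monoʳ-≤ 10 (+-mono-≤ c≤n r≤n))) ⟩
  u * n + (n + 10 * (n + n))   ≡⟨ eq u n ⟩
  (21 + u) * n                 ≤⟨ *-monoˡ-≤ n (≤-trans (+-monoˡ-≤ u 21≤c) (≤-reflexive c+u)) ⟩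
  n * n                        ∎
  where
  open ≤-Reasoning
  c≤n : c ≤ n
  c≤n = subst (c ≤_) c+u (m≤m+n c u)
  r≤n : r ≤ n
  r≤n = subst (r ≤_) r+v (m≤m+n r v)
  v≤n : v ≤ n
  v≤n = subst (v ≤_) r+v (m≤n+m v r)
  eq : ∀ u n → u * n + (n + 10 * (n + n)) ≡ (21 + u) * n
  eq = solve-∀

lost-lines-estimate : ∀ {n c c⁻ r r⁻} → 71 ≤ n → c + c⁻ ≡ n → r + r⁻ ≡ n → 1 ≤ c → 1 ≤ r →
  c⁻ * r⁻ + (n + 10 * (c + r)) ≤ n * n
lost-lines-estimate {n} {c} {u} {r} {v} 71≤n c+u r+v 1≤c 1≤r with 21 ≤? c | 21 ≤? r
... | yes 21≤c | _        = many-lost-lines-estimate c+u r+v 21≤c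
... | no _     | yes 21≤r = ≤-trans
        (≤-reflexive (cong₂ (λ s t → s + (n + 10 * t)) (*-comm u v) (+-comm c r)))
        (many-lost-lines-estimate r+v c+u 21≤r)
lost-lines-estimate {n} {suc c} {u} {suc r} {v} 71≤n c+u r+v _ _ | no _ | no 21≰r = begin
  -- The slack `10 * c` brings the cost to `n + 10 * r + 20 * suc c`. The first lost row pays for
  -- `n`, each further one for 10 with its `n` cells, and each lost column for 20 with its `v` cells
  -- in surviving rows.
  u * v + (n + 10 * (suc c + suc r))                     ≤⟨ m≤m+n _ (10 * c) ⟩
  u * v + (n + 10 * (suc c + suc r)) + 10 * c            ≡⟨ eq₁ u v n c r ⟩
  u * v + n + 10 * r + 20 * suc c                        ≤⟨ +-mono-≤ (+-monoʳ-≤ (u * v + n) (*-monoˡ-≤ r 10≤n)) (*-monoˡ-≤ (suc c) 20≤v) ⟩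
  u * v + n + n * r + v * suc c                          ≡⟨ eq₂ u v n c r ⟩
  (suc c + u) * v + suc r * n                            ≡⟨ cong (λ t → t * v + suc r * n) c+u ⟩
  n * v + suc r * n                                      ≡⟨ eq₃ n v r ⟩
  n * (suc r + v)                                        ≡⟨ cong (n *_) r+v ⟩
  n * n                                                  ∎
  where
  open ≤-Reasoning
  10≤n : 10 ≤ n
  10≤n = ≤-trans (m≤m+n 10 61) 71≤n
  20≤v : 20 ≤ v
  20≤v = +-cancelˡ-≤ 21 20 v (begin
    41          ≤⟨ m≤m+n 41 30 ⟩
    71          ≤⟨ 71≤n ⟩
    n           ≡⟨ sym r+v ⟩
    suc r + v   ≤⟨ +-monoˡ-≤ v (≰⇒≥ 21≰r) ⟩
    21 + v      ∎)
  eq₁ : ∀ u v n c r → u * v + (n + 10 * (suc c + suc r)) + 10 * c ≡ u * v + n + 10 * r + 20 * suc c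
  eq₁ = solve-∀
  eq₂ : ∀ u v n c r → u * v + n + n * r + v * suc c ≡ (suc c + u) * v + suc r * n
  eq₂ = solve-∀
  eq₃ : ∀ n v r → n * v + suc r * n ≡ n * (suc r + v)
  eq₃ = solve-∀

-- The upper bound for matchings of the square

∈⇒1≤length : ∀ {x : A} {L} → x ∈ L → 1 ≤ length L
∈⇒1≤length {L = _ ∷ _} _ = s≤s z≤n

-- Absence of lost rows empties two more quadrants: `(α' , β)` of `x` and `(α , β')` of `y`. With
-- the two assumed empty, each family is left with one layer of the second factor, as `column-bound`
-- requires.
no-lost-row : (M : Matching (Square n) N) → ∀ {α α' β β'} → α ≢ α' → β ≢ β' →
  (∀ {k} → ¬ InX M α β k) → (∀ {k} → ¬ InY M α' β' k) → ¬ ∃ (LostRow M α α' β β') →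
  ∀ k → yb M k ≡ β × xb M k ≡ β'
no-lost-row M {α} {α'} {β} {β'} α≢α' β≢β' noX noY none k = y-part , x-part
  where
  y-part : yb M k ≡ β
  y-part with Fin2-cases β≢β' (yb M k) | Fin2-cases α≢α' (ya M k)
  ... | inj₁ eb | _       = eb
  ... | inj₂ eb | inj₁ ea = contradiction (_ , k , inj₂ ((eb , ea) , refl)) none
  ... | inj₂ eb | inj₂ ea = contradiction (ea , eb) noY
  x-part : xb M k ≡ β'
  x-part with Fin2-cases β≢β' (xb M k) | Fin2-cases α≢α' (xa M k)
  ... | inj₂ eb | _       = eb
  ... | inj₁ eb | inj₁ ea = contradiction (ea , eb) noX
  ... | inj₁ eb | inj₂ ea = contradiction (_ , k , inj₁ ((eb , ea) , refl)) none

frame : (M : Matching (Square n) N) → ∀ {α α' β β'} → α ≢ α' → β ≢ β' →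
  Frame M α α' β β'
    (filter (lostColumn? M α α' β β') (allFin n)) (filter (λ j → ¬? (lostColumn? M α α' β β' j)) (allFin n))
    (filter (lostColumn? (transpose M) β β' α α') (allFin n)) (filter (λ i → ¬? (lostColumn? (transpose M) β β' α α' i)) (allFin n))
frame {n} M {α} {α'} {β} {β'} α≢α' β≢β' = record
  { α≢α' = α≢α'
  ; β≢β' = β≢β'
  ; col  = ∈-filter⁺ (lostColumn? M α α' β β') (∈-allFin _)
  ; row  = ∈-filter⁺ (lostColumn? (transpose M) β β' α α') (∈-allFin _)
  ; col⁻ = split (lostColumn? M α α' β β')
  ; row⁻ = split (lostColumn? (transpose M) β β' α α')
  }
  where
  split : {P : Fin n → Set} (P? : ∀ i → Dec (P i)) → ∀ i → P i ⊎ i ∈ filter (λ i → ¬? (P? i)) (allFin n)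
  split P? i with P? i
  ... | yes p = inj₁ p
  ... | no ¬p = inj₂ (∈-filter⁺ (λ i → ¬? (P? i)) (∈-allFin i) ¬p)

free-quadrant-bound : (M : Matching (Square n) N) → ∀ {α α' β β'} → 71 ≤ n → α ≢ α' → β ≢ β' →
  ¬ (∃[ k ] (InX M α β k ⊎ InY M α' β' k)) → N ≤ n * n
free-quadrant-bound {n} {N} M {α} {α'} {β} {β'} 71≤n α≢α' β≢β' free
  with any? (lostColumn? M α α' β β') | any? (lostColumn? (transpose M) β β' α α')
... | _       | no none = column-bound M (≤-trans (m≤m+n 4 67) 71≤n) β≢β'
        (no-lost-row M α≢α' β≢β' (λ p → free (_ , inj₁ p)) (λ q → free (_ , inj₂ q)) none)
... | no none | _       = column-bound (transpose M) (≤-trans (m≤m+n 4 67) 71≤n) α≢α'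
        (no-lost-row (transpose M) β≢β' α≢α' (λ p → free (_ , inj₁ (swap p))) (λ q → free (_ , inj₂ (swap q))) none)
... | yes lost-col | yes lost-row = ≤-trans
        (lost-lines-bound F lost-col lost-row (λ p → free (_ , inj₁ p)) (λ q → free (_ , inj₂ q)))
        (lost-lines-estimate 71≤n (complement (lostColumn? M α α' β β')) (complement (lostColumn? (transpose M) β β' α α'))
          (∈⇒1≤length (col F (proj₂ lost-col))) (∈⇒1≤length (row F (proj₂ lost-row))))
  where
  F = frame M α≢α' β≢β'
  complement : {P : Fin n → Set} (P? : ∀ i → Dec (P i)) →
    length (filter P? (allFin n)) + length (filter (λ i → ¬? (P? i)) (allFin n)) ≡ n
  complement P? = trans (length-filter-¬ P? (allFin n)) (length-allFin n)

square-matching-bound : 71 ≤ n → Matching (Square n) N → N ≤ n * n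
square-matching-bound {n} {N} 71≤n M with blocked? zero zero (suc zero) (suc zero) | blocked? zero (suc zero) (suc zero) zero
                                    | blocked? (suc zero) zero zero (suc zero) | blocked? (suc zero) (suc zero) zero zero
  where
  blocked? : ∀ α β α' β' → Dec (∃[ k ] (InX M α β k ⊎ InY M α' β' k))
  blocked? α β α' β' = any? λ k → inX? M α β k ⊎-dec inY? M α' β' k
... | no free | _       | _       | _       = free-quadrant-bound M 71≤n (λ ()) (λ ()) free
... | _       | no free | _       | _       = free-quadrant-bound M 71≤n (λ ()) (λ ()) free
... | _       | _       | no free | _       = free-quadrant-bound M 71≤n (λ ()) (λ ()) free
... | _       | _       | _       | no free = free-quadrant-bound M 71≤n (λ ()) (λ ()) free
-- No quadrant is free, so the `y` number only linearly in `n`: four times `1 + n * 6`, below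
-- `25 * n`.
... | yes b₀₀ | yes b₀₁ | yes b₁₀ | yes b₁₁ = begin
  N                                                  ≤⟨ AtMost-total quadrants (AtMost-∪ id (quadrant-bound M (λ ()) (λ ()) b₀₀)
                                                          (AtMost-∪ id (quadrant-bound M (λ ()) (λ ()) b₀₁)
                                                            (AtMost-∪ id (quadrant-bound M (λ ()) (λ ()) b₁₀)
                                                              (quadrant-bound M (λ ()) (λ ()) b₁₁)))) ⟩
  q + (q + (q + q))                                  ≡⟨ eq n ⟩
  4 + 24 * n                                         ≤⟨ +-monoˡ-≤ (24 * n) (≤-trans (m≤m+n 4 67) 71≤n) ⟩
  25 * n                                             ≤⟨ *-monoˡ-≤ n (≤-trans (m≤m+n 25 46) 71≤n) ⟩
  n * n                                              ∎
  where
  open ≤-Reasoning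
  q = 1 + n * 6
  eq : ∀ n → (1 + n * 6) + ((1 + n * 6) + ((1 + n * 6) + (1 + n * 6))) ≡ 4 + 24 * n
  eq = solve-∀
  quadrants : ∀ k → InY M zero zero k ⊎ InY M zero (suc zero) k ⊎ InY M (suc zero) zero k ⊎ InY M (suc zero) (suc zero) k
  quadrants k with Fin2-cases {zero} {suc zero} (λ ()) (ya M k) | Fin2-cases {zero} {suc zero} (λ ()) (yb M k)
  ... | inj₁ a | inj₁ b = inj₁ (a , b)
  ... | inj₁ a | inj₂ b = inj₂ (inj₁ (a , b))
  ... | inj₂ a | inj₁ b = inj₂ (inj₂ (inj₁ (a , b)))
  ... | inj₂ a | inj₂ b = inj₂ (inj₂ (inj₂ (a , b)))

-- Extremal sets

layer : ∀ n → List (V (Gn n))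
layer n = map (zero ,_) (allFin n)

∈-layer : ∀ (i : Fin n) → (zero , i) ∈ layer n
∈-layer i = ∈-map⁺ (zero ,_) (∈-allFin i)

layer-row : ∀ {u} → u ∈ layer n → proj₁ u ≡ zero
layer-row u∈ with ∈-map⁻ (zero ,_) u∈
... | _ , _ , refl = refl

layer-unique : ∀ n → Unique (layer n)
layer-unique n = map⁺ (cong proj₂) (allFin⁺ n)

length-layer : ∀ n → length (layer n) ≡ n
length-layer n = trans (length-map (zero ,_) (allFin n)) (length-allFin n)

rung : ∀ (i : Fin n) → Adj (Gn n) (zero , i) (suc zero , i)
rung i = inj₂ ((λ ()) , refl)

rung-only : ∀ {u} {i : Fin n} → u ∈ layer n → Adj (Gn n) u (suc zero , i) → u ≡ (zero , i)
rung-only u∈ adj with layer-row u∈ | adj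
... | refl | inj₂ (_ , refl) = refl

layer-minimal : MinimalDominating (Gn n) (layer n)
layer-minimal {n} = private⇒minimal dom priv
  where
  dom : Dominating (Gn n) (layer n)
  dom (zero     , i) = inj₁ (∈-layer i)
  dom (suc zero , i) = inj₂ ((zero , i) , ∈-layer i , rung i)
  priv : ∀ {x} → x ∈ layer n → ∃ (PrivateNeighbour (Gn n) (layer n) x)
  priv {_ , i} x∈ with layer-row x∈
  ... | refl = (suc zero , i) , inj₂ (rung i) , only
    where
    only : ∀ {u} → u ∈ layer n → Gn n ⟦ u ~ (suc zero , i) ⟧ → u ≡ (zero , i)
    only u∈ (inj₁ refl) = contradiction (layer-row u∈) λ ()
    only u∈ (inj₂ adj)  = rung-only u∈ adj

square-layer : ∀ n → List (V (Square n))
square-layer n = cartesianProduct (layer n) (layer n)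

length-cartesianProduct : ∀ (xs : List A) (ys : List B) → length (cartesianProduct xs ys) ≡ length xs * length ys
length-cartesianProduct []       ys = refl
length-cartesianProduct (x ∷ xs) ys = trans (length-++ (map (x ,_) ys))
  (cong₂ _+_ (length-map (x ,_) ys) (length-cartesianProduct xs ys))

other : 2 ≤ n → (i : Fin n) → ∃[ j ] (j ≢ i)
other (s≤s (s≤s _)) zero    = suc zero , λ ()
other (s≤s (s≤s _)) (suc _) = zero , λ ()

-- Domination in a direct product is obtained from neighbours in both factors at once, so a layer
-- has to dominate its own vertices by proper neighbours; this takes a second vertex in it. Private
-- neighbours are the opposite ends of both rungs.
square-layer-minimal : 2 ≤ n → MinimalDominating (Square n) (square-layer n)
square-layer-minimal {n} 2≤n = private⇒minimal dom priv
  where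
  total : ∀ v → ∃[ u ] (u ∈ layer n × Adj (Gn n) u v)
  total (zero     , i) = (zero , proj₁ (other 2≤n i)) , ∈-layer _ , inj₁ (refl , proj₂ (other 2≤n i))
  total (suc zero , i) = (zero , i) , ∈-layer i , rung i
  dom : Dominating (Square n) (square-layer n)
  dom (v , v') with total v | total v'
  ... | u , u∈ , adj | u' , u'∈ , adj' = inj₂ ((u , u') , ∈-cartesianProduct⁺ u∈ u'∈ , adj , adj')
  priv : ∀ {x} → x ∈ square-layer n → ∃ (PrivateNeighbour (Square n) (square-layer n) x)
  priv {(_ , i) , (_ , j)} x∈ with ∈-cartesianProduct⁻ (layer n) (layer n) x∈
  ... | x₁∈ , x₂∈ with layer-row x₁∈ | layer-row x₂∈
  ... | refl | refl = ((suc zero , i) , (suc zero , j)) , inj₂ (rung i , rung j) , only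
    where
    only : ∀ {u} → u ∈ square-layer n → Square n ⟦ u ~ ((suc zero , i) , (suc zero , j)) ⟧ → u ≡ ((zero , i) , (zero , j))
    only u∈ u~v with ∈-cartesianProduct⁻ (layer n) (layer n) u∈ | u~v
    ... | u₁∈ , _   | inj₁ refl          = contradiction (layer-row u₁∈) λ ()
    ... | u₁∈ , u₂∈ | inj₂ (adj₁ , adj₂) = cong₂ _,_ (rung-only u₁∈ adj₁) (rung-only u₂∈ adj₂)

theorem16 : (n : ℕ) → 71 ≤ n →
    IsUpperDominationNumber (Gn n ⊠ Gn n) (n * n) × IsUpperDominationNumber (Gn n) n
theorem16 n 71≤n =
  ( (square-layer n , cartesianProduct⁺ (layer-unique n) (layer-unique n) , square-layer-minimal (≤-trans (m≤m+n 2 69) 71≤n)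
      , trans (length-cartesianProduct (layer n) (layer n)) (cong₂ _*_ (length-layer n) (length-layer n)))
  , λ D uniq min → square-matching-bound 71≤n (minimal⇒matching (⊠-finite (prism-finite n) (prism-finite n)) uniq min) ) ,
  ( (layer n , layer-unique n , layer-minimal , length-layer n)
  , λ D uniq min → prism-matching-bound (≤-trans (m≤m+n 4 67) 71≤n) (minimal⇒matching (prism-finite n) uniq min) )
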